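{- Let $D=(Q,\Sigma,\delta,q_0,A)$ and $D'=(Q',\Sigma,\delta',q_0',A')$ be DFAs over the same alphabet with $L(D)\sim L(D')$. Then $S(D)=S(D')$.
   Context: All DFAs are complete and all states are reachable from the start state. For languages, $L\sim L'$ means the symmetric difference $L\triangle L'$ is finite; this is an equivalence relation, and $[L]$ denotes the equivalence class (language-class) of $L$. For a state $q$ of a DFA $D=(Q,\Sigma,\delta,q_0,A)$, the \emph{induced language} $L(q)$ is the language recognized by $(Q,\Sigma,\delta,q,A)$. Define $S(D)=\{[L(q)]: q\in Q\}$. -}

module Defs where

open import Level using (0ℓ; suc)
open import Data.Fin.Base using (Fin)
open import Data.List.Base using (List; foldl)
open import Data.List.Membership.Propositional using () renaming (_∈_ to _∈ₗ_)
open import Data.Product.Base using (∃)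
open import Function.Bundles using (_↔_)
open import Relation.Binary.PropositionalEquality.Core using (_≡_)
open import Relation.Unary using (Pred; Decidable; _∈_; _⊆_; _∪_; _∖_; _≐_)

FiniteType : Set → Set
FiniteType X = ∃ λ n → X ↔ Fin n

Word : Set → Set
Word Σ = List Σ

Language : Set → Set₁
Language Σ = Pred (Word Σ) 0ℓ

-- The list may contain words outside L.  Classically this is the same as
-- listing L exactly, but it does not force membership in L to be decidable.
-- With an exact listing, _∼_ below would fail to be constructively transitive.
FiniteLanguage : {Σ : Set} → Language Σ → Set
FiniteLanguage L = ∃ λ ws → L ⊆ (_∈ₗ ws)

infixl 6 _△_
_△_ : {Σ : Set} → Language Σ → Language Σ → Language Σ
L △ L′ = (L ∖ L′) ∪ (L′ ∖ L)

infix 4 _∼_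
_∼_ : {Σ : Set} → Language Σ → Language Σ → Set
L ∼ L′ = FiniteLanguage (L △ L′)

LanguageClass : Set → Set₁
LanguageClass Σ = Pred (Language Σ) 0ℓ

[_] : {Σ : Set} → Language Σ → LanguageClass Σ
[ L ] = λ L′ → L ∼ L′

record DFA (Σ : Set) : Set₁ where
  field
    Q        : Set
    Q-finite : FiniteType Q
    δ        : Q → Σ → Q
    q₀       : Q
    A        : Pred Q 0ℓ
    A?       : Decidable A

  δ* : Q → Word Σ → Q
  δ* = foldl δ

open DFA

L : {Σ : Set} → DFA Σ → Language Σ
L D = λ w → δ* D (q₀ D) w ∈ A D

AllReachable : {Σ : Set} → DFA Σ → Set
AllReachable D = ∀ q → ∃ λ w → δ* D (q₀ D) w ≡ q

-- Reachability is not part of DFA because restarting at q need not preserve it.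
startingAt : {Σ : Set} (D : DFA Σ) → Q D → DFA Σ
startingAt D q = record D { q₀ = q }

inducedL : {Σ : Set} (D : DFA Σ) → Q D → Language Σ
inducedL D q = L (startingAt D q)

-- Classes are predicates, so "C is the class [L(q)]" is extensional equality _≐_.
S : {Σ : Set} → DFA Σ → Pred (LanguageClass Σ) (suc 0ℓ)
S D = λ C → ∃ λ q → C ≐ [ inducedL D q ]

{-# OPTIONS --safe #-}
-- If q = δ*(q₀, w), then q is matched with q′ = δ′*(q₀′, w): a word u separates
-- L(q) from L(q′) exactly when w ++ u separates L(D) from L(D′), so only
-- finitely many u do.
module Submission where

open import Defs
open import Data.List.Base using (List; []; _∷_; _++_; drop; length; map)
open import Data.List.Membership.Propositional using () renaming (_∈_ to _∈ₗ_)
open import Data.List.Membership.Propositional.Properties using (∈-map⁺; ∈-++⁺ˡ; ∈-++⁺ʳ)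
open import Data.List.Properties using (foldl-++)
open import Data.Product.Base using (_,_)
open import Data.Sum.Base using (inj₁; inj₂; swap)
open import Function.Base using (_∘_)
open import Relation.Binary.PropositionalEquality using (_≡_; refl; sym; subst)
open import Relation.Nullary.Decidable using (yes; no)
open import Relation.Unary using (Decidable; _∈_; _⊆_; _≐_)
open import Relation.Unary.Properties using (≐-trans)

open DFA

-- By reachability each state of `D` is reached by some word `w`; reading `w` in `D′` reaches a
-- state whose induced language is `∼`-related (`inducedL-δ*-∼`), hence of the same class
-- (`∼⇒[]≐[]`). This gives `S D ⊆ S D′`, and `∼-sym` gives the converse.

private
  variable
    Σ : Set
    K M N : Language Σ

∼-sym : M ∼ N → N ∼ M
∼-sym (ws , M△N⊆ws) = ws , M△N⊆ws ∘ swap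

-- Only the middle language has to be decided: a word separating K from N
-- separates M from one of them.
∼-trans : Decidable M → K ∼ M → M ∼ N → K ∼ N
∼-trans {M = M} {K = K} {N = N} M? (us , K△M⊆us) (vs , M△N⊆vs) = us ++ vs , K△N⊆us++vs
  where
  K△N⊆us++vs : K △ N ⊆ (_∈ₗ us ++ vs)
  K△N⊆us++vs {w} w∈K△N with M? w | w∈K△N
  ... | yes w∈M | inj₁ (_   , w∉N) = ∈-++⁺ʳ us (M△N⊆vs (inj₁ (w∈M , w∉N)))
  ... | no  w∉M | inj₁ (w∈K , _  ) = ∈-++⁺ˡ (K△M⊆us (inj₁ (w∈K , w∉M)))
  ... | yes w∈M | inj₂ (_   , w∉K) = ∈-++⁺ˡ (K△M⊆us (inj₂ (w∈M , w∉K)))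
  ... | no  w∉M | inj₂ (w∈N , _  ) = ∈-++⁺ʳ us (M△N⊆vs (inj₂ (w∈N , w∉M)))

-- Each inclusion is transitivity through `M` or `N`, so the other members of the class need not be
-- decidable.
∼⇒[]≐[] : Decidable M → Decidable N → M ∼ N → [ M ] ≐ [ N ]
∼⇒[]≐[] M? N? M∼N = ∼-trans M? (∼-sym M∼N) , ∼-trans N? M∼N

drop-length-++ : {X : Set} (xs ys : List X) → drop (length xs) (xs ++ ys) ≡ ys
drop-length-++ []       ys = refl
drop-length-++ (x ∷ xs) ys = drop-length-++ xs ys

-- Cutting `length w` letters off every listed word suffices: words not starting with `w` only add
-- harmless extra entries.
inducedL-δ*-∼ : (D D′ : DFA Σ) (w : Word Σ) → L D ∼ L D′ →
  inducedL D (δ* D (q₀ D) w) ∼ inducedL D′ (δ* D′ (q₀ D′) w)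
inducedL-δ*-∼ D D′ w (ws , LD△LD′⊆ws) = map (drop (length w)) ws , suffix∈
  where
  suffix∈ : inducedL D (δ* D (q₀ D) w) △ inducedL D′ (δ* D′ (q₀ D′) w)
            ⊆ (_∈ₗ map (drop (length w)) ws)
  suffix∈ {u} u∈△
    -- Now `u∈△` says that `w ++ u` lies in `L D △ L D′`.
    rewrite sym (foldl-++ (δ D) (q₀ D) w u) | sym (foldl-++ (δ D′) (q₀ D′) w u) =
    subst (_∈ₗ map (drop (length w)) ws) (drop-length-++ w u)
      (∈-map⁺ (drop (length w)) (LD△LD′⊆ws u∈△))

L? : (D : DFA Σ) → Decidable (L D)
L? D w = A? D (δ* D (q₀ D) w)

S-mono-∼ : (D D′ : DFA Σ) → AllReachable D → L D ∼ L D′ → S D ⊆ S D′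
S-mono-∼ D D′ reach LD∼LD′ (q , C≐[Lq]) with reach q
... | w , refl = q′ , ≐-trans C≐[Lq]
      (∼⇒[]≐[] (L? (startingAt D q)) (L? (startingAt D′ q′)) (inducedL-δ*-∼ D D′ w LD∼LD′))
  where
  q′ = δ* D′ (q₀ D′) w

mainTheorem3 : {Σ : Set} → FiniteType Σ →
    (D D′ : DFA Σ) → AllReachable D → AllReachable D′ →
    L D ∼ L D′ → S D ≐ S D′
mainTheorem3 _ D D′ reach reach′ LD∼LD′ =
  S-mono-∼ D D′ reach LD∼LD′ , S-mono-∼ D′ D reach′ (∼-sym LD∼LD′)
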